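{- The number of locally-valid MV assignments of any $m\times n$ modified Miura-ori crease pattern is equal to the number of locally-valid MV assignments of an $m\times n$ standard Miura-ori crease pattern.
   Context: **Modified Miura-ori.** An $m\times n$ (modified) Miura-ori crease pattern has $m$ rows and $n$ columns of faces. It is formed by $m-1$ straight horizontal crease lines crossed by $n-1$ vertical zig-zag columns of creases. In coordinates: the horizontal creases lie on the lines $y=i$, $1\le i\le m-1$, of the paper $P$ with $0\le y\le m$; for $1\le j\le n-1$ the $j$-th zig-zag is the polyline through the points $p_{i,j}=(x_j+\epsilon_j(-1)^i\delta,\; i)$, $i=0,\dots,m$, where $\delta>0$, $\epsilon_j\in\{1,-1\}$, and $x_1<\cdots<x_{n-1}$ are spaced so that the zig-zags are pairwise disjoint and interior to the left and right edges of $P$. The interior vertices are the $p_{i,j}$ with $1\le i\le m-1$, $1\le j\le n-1$, each of degree 4; the creases are the segments into which the horizontal lines and zig-zags are cut by these vertices (those at the ends terminate on the boundary of $P$). The standard Miura-ori is the case where all $\epsilon_j$ are equal (its faces away from the left and right edges are congruent-angled parallelograms); a modified Miura-ori is obtained from the standard one by reflecting some of the zig-zag columns from left to right, i.e. by an arbitrary choice of signs $\epsilon_j$. **MV assignments.** A MV assignment is a function $\mu$ from the set of creases to $\{1,-1\}$ (mountain $=1$, valley $=-1$). It is locally-valid if at each interior vertex the creases at that vertex fold flat without self-intersection. Every interior vertex here is a bird's foot: two consecutive equal acute sector angles bordered by three creases (the toes), and two equal obtuse sector angles, meeting at the fourth crease (the heel, collinear with the middle toe). Such a vertex is validly assigned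 if and only if $\mu(\text{heel})$ equals the sum of the values of $\mu$ on the three toes (known characterization). -}

module Defs where

open import Algebra.Bundles using (CommutativeRing)
import Algebra.Definitions.RawMonoid as RawMonoid
open import Data.Fin as Fin using (Fin; zero; suc; inject₁; toℕ)
import Data.Fin.Properties as Fin
open import Data.Integer as ℤ using (ℤ; _◃_)
open import Data.List using ([]; _∷_)
open import Data.List.Relation.Unary.AllPairs using (allPairs?)
open import Data.List.Relation.Unary.Unique.Propositional using (Unique)
open import Data.Nat as ℕ using (ℕ; zero; suc)
open import Data.Product using (∃-syntax; Σ; _×_; _,_; proj₁; proj₂)
open import Data.Sign as Sign using (Sign; opposite)
open import Data.Sum using (_⊎_)
import Data.Vec.Functional as Vector
open import Function.Base using (_∘_)
open import Function.Bundles using (Inverse; _⇔_; mk⇔)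
open import Level using (Level; 0ℓ; _⊔_) renaming (suc to lsuc)
open import Relation.Binary.Bundles using (Setoid)
import Relation.Binary.Construct.On as On
open import Relation.Binary.Core using (Rel)
open import Relation.Binary.PropositionalEquality
  using (_≡_; setoid; _→-setoid_)
open import Relation.Binary.Structures using (IsStrictTotalOrder)
open import Relation.Nullary.Decidable
  using (Dec; _×-dec_; _⊎-dec_; _→-dec_; ¬?; map′; from-yes)
open import Relation.Nullary.Negation using (¬_)

-- The plane of the paper has coordinates in an arbitrary ordered field, of
-- which ℝ is the intended instance.
record OrderedField (c ℓ₁ ℓ₂ : Level) : Set (lsuc (c ⊔ ℓ₁ ⊔ ℓ₂)) where
  field
    commutativeRing : CommutativeRing c ℓ₁
  open CommutativeRing commutativeRing public
  infix 4 _<_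
  field
    _<_                : Rel Carrier ℓ₂
    isStrictTotalOrder : IsStrictTotalOrder _≈_ _<_
    0<1                : 0# < 1#
    +-monoʳ-<          : ∀ z {x y} → x < y → z + x < z + y
    *-pos              : ∀ {x y} → 0# < x → 0# < y → 0# < x * y
    inverse            : ∀ x → ¬ x ≈ 0# → ∃[ y ] x * y ≈ 1#

------------------------------------------------------------------------
-- Mountain-valley labels and flat foldings of a bird's foot

-- Mountain is 1, valley is -1.
pattern mountain = Sign.+
pattern valley   = Sign.-

value : Sign → ℤ
value s = s ◃ 1

Between : ∀ {n} → Fin n → Fin n → Fin n → Set
Between a b x = (a Fin.< x × x Fin.< b) ⊎ (b Fin.< x × x Fin.< a)

-- `up` and `over` are the heights of the two sectors joined by a crease, the
-- first keeping its top side up, the second turned over. The crease is a valley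
-- when the top sides face each other.
Creased : ∀ {n} → Sign → (up over : Fin n) → Set
Creased mountain up over = over Fin.< up
Creased valley   up over = up Fin.< over

-- The sectors of a bird's foot, in cyclic order, are
--   heel | B₁ | toe₁ | A₁ | mid | A₂ | toe₂ | B₂ | heel
-- where A₁, A₂ have the same acute angle α and B₁, B₂ the obtuse angle π - α.
-- In the folded state, put mid at angle 0. Both outer toes then lie at angle α
-- and the heel at 2α - π < 0, so that A₁, A₂ cover [0, α] and B₁, B₂ cover
-- [2α - π, α]. All four sectors lie over [0, α], hence they have distinct
-- heights b₁, a₁, a₂, b₂ there. The paper does not cross itself exactly when
--  * neither B₁ nor B₂, whose interiors contain angle 0, passes between
--    the two sectors A₁, A₂ joined at mid;
--  * the outer toes, which lie on each other and join A₁ to B₁ and A₂ to B₂,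
--    are not interlaced.
-- Nothing else reaches the heel. Up to turning the whole paper over, B₁ and A₂
-- keep their top side up while A₁ and B₂ are turned over.
FlatStack : (heel toe₁ mid toe₂ : Sign) (b₁ a₁ a₂ b₂ : Fin 4) → Set
FlatStack heel toe₁ mid toe₂ b₁ a₁ a₂ b₂ =
  Unique (b₁ ∷ a₁ ∷ a₂ ∷ b₂ ∷ []) ×
  Creased heel b₁ b₂ × Creased toe₁ b₁ a₁ ×
  Creased mid  a₂ a₁ × Creased toe₂ a₂ b₂ ×
  ¬ Between a₁ a₂ b₁ × ¬ Between a₁ a₂ b₂ ×
  (Between a₁ b₁ a₂ → Between a₁ b₁ b₂) ×
  (Between a₁ b₁ b₂ → Between a₁ b₁ a₂)

FoldsFlat : (heel toe₁ mid toe₂ : Sign) → Set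
FoldsFlat heel toe₁ mid toe₂ =
  ∃[ b₁ ] ∃[ a₁ ] ∃[ a₂ ] ∃[ b₂ ] FlatStack heel toe₁ mid toe₂ b₁ a₁ a₂ b₂

between? : ∀ {n} (a b x : Fin n) → Dec (Between a b x)
between? a b x =
  (a Fin.<? x ×-dec x Fin.<? b) ⊎-dec (b Fin.<? x ×-dec x Fin.<? a)

creased? : ∀ {n} s (up over : Fin n) → Dec (Creased s up over)
creased? mountain up over = over Fin.<? up
creased? valley   up over = up Fin.<? over

foldsFlat? : ∀ heel toe₁ mid toe₂ → Dec (FoldsFlat heel toe₁ mid toe₂)
foldsFlat? heel toe₁ mid toe₂ =
  Fin.any? λ b₁ → Fin.any? λ a₁ → Fin.any? λ a₂ → Fin.any? λ b₂ →
  allPairs? (λ i j → ¬? (i Fin.≟ j)) (b₁ ∷ a₁ ∷ a₂ ∷ b₂ ∷ []) ×-dec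
  creased? heel b₁ b₂ ×-dec creased? toe₁ b₁ a₁ ×-dec
  creased? mid  a₂ a₁ ×-dec creased? toe₂ a₂ b₂ ×-dec
  ¬? (between? a₁ a₂ b₁) ×-dec ¬? (between? a₁ a₂ b₂) ×-dec
  (between? a₁ b₁ a₂ →-dec between? a₁ b₁ b₂) ×-dec
  (between? a₁ b₁ b₂ →-dec between? a₁ b₁ a₂)

ToeSum : (heel toe₁ mid toe₂ : Sign) → Set
ToeSum heel toe₁ mid toe₂ =
  value heel ≡ value toe₁ ℤ.+ value mid ℤ.+ value toe₂

all-signs? : ∀ {p} {P : Sign → Set p} → (∀ s → Dec (P s)) → Dec (∀ s → P s)
all-signs? P? = map′ (λ { (p , q) Sign.+ → p ; (p , q) Sign.- → q })
  (λ f → f Sign.+ , f Sign.-) (P? Sign.+ ×-dec P? Sign.-)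

foldsFlat⇔toeSum : ∀ heel toe₁ mid toe₂ →
  FoldsFlat heel toe₁ mid toe₂ ⇔ ToeSum heel toe₁ mid toe₂
foldsFlat⇔toeSum heel toe₁ mid toe₂ =
  mk⇔ (proj₁ (both heel toe₁ mid toe₂)) (proj₂ (both heel toe₁ mid toe₂))
  where
  toeSum? : ∀ h s m t → Dec (ToeSum h s m t)
  toeSum? h s m t = value h ℤ.≟ value s ℤ.+ value m ℤ.+ value t

  both : ∀ h s m t → (FoldsFlat h s m t → ToeSum h s m t)
                   × (ToeSum h s m t → FoldsFlat h s m t)
  both = from-yes (all-signs? λ h → all-signs? λ s → all-signs? λ m →
    all-signs? λ t → (foldsFlat? h s m t →-dec toeSum? h s m t)
               ×-dec (toeSum? h s m t →-dec foldsFlat? h s m t))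

------------------------------------------------------------------------
-- Creases and vertices

-- A pattern with r horizontal crease lines and c zig-zags, i.e. with suc r rows
-- and suc c columns of faces. The line at height y = suc (toℕ i) has index i.
data Crease (r c : ℕ) : Set where
  -- the j-th segment, from the left, of line i
  horizontal : Fin r → Fin (suc c) → Crease r c
  -- the segment of zig-zag j between y = toℕ i and y = suc (toℕ i)
  zigzag     : Fin c → Fin (suc r) → Crease r c

Vertex : ℕ → ℕ → Set
Vertex r c = Fin r × Fin c

data Port : Set where
  east north west south : Port

-- counterclockwise successor
next : Port → Port
next east  = north
next north = west
next west  = south
next south = east

creaseAt : ∀ {r c} → Vertex r c → Port → Crease r c
creaseAt (i , j) east  = horizontal i (suc j)
creaseAt (i , j) north = zigzag j (suc i)
creaseAt (i , j) west  = horizontal i (inject₁ j)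
creaseAt (i , j) south = zigzag j (inject₁ i)

MVAssignment : ℕ → ℕ → Set
MVAssignment r c = Crease r c → Sign

alternating : ℕ → Sign
alternating zero    = Sign.+
alternating (suc i) = opposite (alternating i)

snoc : ∀ {a} {A : Set a} {n} → (Fin n → A) → A → Fin (suc n) → A
snoc {n = zero}  f x _       = x
snoc {n = suc n} f x zero    = f zero
snoc {n = suc n} f x (suc j) = snoc (f ∘ suc) x j

------------------------------------------------------------------------
-- Crease patterns

module _ {a ℓ₁ ℓ₂ : Level} (F : OrderedField a ℓ₁ ℓ₂) where
  open OrderedField F

  Point : Set a
  Point = Carrier × Carrier

  dot : Point → Point → Carrier
  dot (x , y) (x′ , y′) = x * x′ + y * y′

  signed : Sign → Carrier → Carrier
  signed Sign.+ d = d
  signed Sign.- d = - d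

  fromℕ : ℕ → Carrier
  fromℕ n = RawMonoid._×_ +-rawMonoid n 1#

  -- Zig-zags are linear between consecutive heights 0, 1, …, suc r, so being
  -- disjoint and inside the paper amounts to being in order at those heights.
  record ModifiedMiuraOri (r c : ℕ) : Set (a ⊔ ℓ₁ ⊔ ℓ₂) where
    field
      left right : Carrier
      δ          : Carrier
      x          : Fin c → Carrier
      ε          : Fin c → Sign

    abscissa : ℕ → Fin c → Carrier
    abscissa i j = x j + signed (ε j Sign.* alternating i) δ

    field
      left<right   : left < right
      0<δ          : 0# < δ
      x-increasing : ∀ {j k} → j Fin.< k → x j < x k
      disjoint     : ∀ {i j k} → i ℕ.≤ suc r → j Fin.< k →
                     abscissa i j < abscissa i k
      left<zigzag  : ∀ {i} j → i ℕ.≤ suc r → left < abscissa i j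
      zigzag<right : ∀ {i} j → i ℕ.≤ suc r → abscissa i j < right

    point : ℕ → Fin c → Point
    point i j = abscissa i j , fromℕ i

    position : Vertex r c → Point
    position (i , j) = point (suc (toℕ i)) j

    -- the left or lower endpoint
    start : Crease r c → Point
    start (horizontal i j) =
      ((left , fromℕ (suc (toℕ i))) Vector.∷ point (suc (toℕ i))) j
    start (zigzag j i)     = point (toℕ i) j

    -- the right or upper endpoint
    end : Crease r c → Point
    end (horizontal i j) =
      snoc (point (suc (toℕ i))) (right , fromℕ (suc (toℕ i))) j
    end (zigzag j i)     = point (suc (toℕ i)) j

    farEnd : Vertex r c → Port → Point
    farEnd v east  = end (creaseAt v east)
    farEnd v north = end (creaseAt v north)
    farEnd v west  = start (creaseAt v west)
    farEnd v south = start (creaseAt v south)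

    direction : Vertex r c → Port → Point
    direction v p =
      proj₁ (farEnd v p) - proj₁ (position v) ,
      proj₂ (farEnd v p) - proj₂ (position v)

    Obtuse : Vertex r c → Port → Port → Set ℓ₂
    Obtuse v p q = dot (direction v p) (direction v q) < 0#

    -- The heel is the crease between the two obtuse sectors.
    IsHeel : Vertex r c → Port → Set ℓ₂
    IsHeel v h = Obtuse v h (next h) × Obtuse v h (next (next (next h)))

    LocallyValidAt : MVAssignment r c → Vertex r c → Set ℓ₂
    LocallyValidAt μ v = ∃[ h ] IsHeel v h ×
      FoldsFlat (μ (creaseAt v h))
                (μ (creaseAt v (next h)))
                (μ (creaseAt v (next (next h))))
                (μ (creaseAt v (next (next (next h)))))

    LocallyValid : MVAssignment r c → Set ℓ₂
    LocallyValid μ = ∀ v → LocallyValidAt μ v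

    IsStandard : Set
    IsStandard = ∀ j k → ε j ≡ ε k

    -- Assignments are identified when they agree on every crease.
    locallyValidAssignments : Setoid ℓ₂ 0ℓ
    locallyValidAssignments =
      On.setoid {B = Σ (MVAssignment r c) LocallyValid}
        (Crease r c →-setoid Sign) proj₁

  open ModifiedMiuraOri public using (IsStandard; locallyValidAssignments)

HasCardinality : ∀ {a ℓ} → Setoid a ℓ → ℕ → Set (a ⊔ ℓ)
HasCardinality S n = Inverse S (setoid (Fin n))

{-# OPTIONS --safe #-}

-- Let σ be the sign of the displacement of the vertex from its zig-zag's axis:
-- the heel of the bird's foot points east if σ = 1 and west if σ = -1. In both
-- cases validity reads  μ(E) = σ μ(N) + μ(W) + σ μ(S).  At row i of zig-zag j,
-- σ = ε_j (-1)^i, so multiplying the labels of each zig-zag j by ε_j is a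
-- bijection from the valid assignments to the solutions of a system of
-- equations which does not depend on the pattern.

module Submission where

open import Defs
import Algebra.Properties.AbelianGroup as AbelianGroupProperties
import Algebra.Properties.Ring as RingProperties
open import Data.Empty using (⊥-elim)
open import Data.Fin as Fin using (Fin; zero; suc; inject₁; toℕ)
import Data.Fin.Properties as Fin
open import Data.Integer as ℤ using ()
open import Data.Nat as ℕ using (ℕ; zero; suc)
import Data.Nat.Properties as ℕ
open import Data.Product as Product
  using (∃; ∃-syntax; Σ; _×_; _,_; proj₁; proj₂; curry; uncurry)
open import Data.Sign as Sign using (Sign; opposite)
import Data.Sign.Properties as Sign
open import Data.Sum using (inj₁; inj₂)
open import Data.Sum.Function.Propositional using (_⊎-↔_)
import Data.Vec.Functional as Vector
open import Function.Base using (_∘_; id)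
open import Function.Bundles using (Equivalence; Inverse; _⇔_; _↔_; mk⇔; mk↔ₛ′)
open import Function.Consequences.Setoid
  using (strictlyInverseˡ⇒inverseˡ; strictlyInverseʳ⇒inverseʳ)
open import Function.Construct.Composition as Compose using (_⇔-∘_)
open import Function.Properties.Inverse using (↔-sym; ↔-trans)
open import Level using (Level)
open import Relation.Binary.Bundles using (Setoid)
import Relation.Binary.Construct.On as On
open import Relation.Binary.PropositionalEquality as ≡
  using (_≡_; refl; cong; cong₂; subst; setoid; _→-setoid_)
import Relation.Binary.Reasoning.Setoid as ≈-Reasoning
open import Relation.Binary.Structures using (IsStrictTotalOrder)
open import Relation.Nullary using (Dec; yes; no; ¬_)
open import Relation.Nullary.Decidable using (_×-dec_; _→-dec_; from-yes; map′)
open import Relation.Unary using (Pred; Decidable)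

private
  variable
    a b ℓ ℓ′ ℓ₁ ℓ₂ p q : Level
    r c n : ℕ

-- Finite setoids

module _ {S : Setoid a ℓ} {T : Setoid b ℓ′} where
  private
    module S = Setoid S
    module T = Setoid T

  mkInverseₛ : (to : S.Carrier → T.Carrier) (from : T.Carrier → S.Carrier) →
    (∀ {x y} → x S.≈ y → to x T.≈ to y) →
    (∀ {x y} → x T.≈ y → from x S.≈ from y) →
    (∀ y → to (from y) T.≈ y) → (∀ x → from (to x) S.≈ x) → Inverse S T
  mkInverseₛ to from to-cong from-cong to∘from from∘to = record
    { to        = to
    ; from      = from
    ; to-cong   = to-cong
    ; from-cong = from-cong
    ; inverse   = strictlyInverseˡ⇒inverseˡ S T {f⁻¹ = from} to-cong to∘from
                , strictlyInverseʳ⇒inverseʳ S T {f = to} from-cong from∘to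
    }

Restrict : (S : Setoid a ℓ) → Pred (Setoid.Carrier S) p → Setoid _ _
Restrict S P = On.setoid {B = Σ _ P} S proj₁

-- Equality in `Restrict` ignores the proofs, so all the inverse laws are inherited from `I`.
-- `locallyValidAssignments` unfolds to such a restriction.
Restrict⁺ : {S : Setoid a ℓ} {T : Setoid b ℓ′}
  {P : Pred (Setoid.Carrier S) p} {Q : Pred (Setoid.Carrier T) q} →
  (∀ {x y} → Setoid._≈_ T x y → Q x → Q y) →
  (I : Inverse S T) → (∀ x → P x ⇔ Q (Inverse.to I x)) →
  Inverse (Restrict S P) (Restrict T Q)
Restrict⁺ {T = T} Q-resp I P⇔Q = mkInverseₛ
  (λ (x , px) → to x , Equivalence.to (P⇔Q x) px)
  -- `to (from y)` equals `y` only in the sense of `T`, so `qy` is transported before it is pulled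
  -- back.
  (λ (y , qy) → from y , Equivalence.from (P⇔Q (from y))
                           (Q-resp (Setoid.sym T (strictlyInverseˡ y)) qy))
  to-cong from-cong
  (λ (y , _) → strictlyInverseˡ y) (λ (x , _) → strictlyInverseʳ x)
  where open Inverse I

-- Induction on `n`: index `zero` adds one to the count of the remaining indices exactly when
-- `P zero` holds. Different proofs for one index are identified, so nothing is counted twice.
Restrict-Fin-finite : ∀ {n} {P : Pred (Fin n) p} → Decidable P →
  ∃ (HasCardinality (Restrict (setoid (Fin n)) P))
Restrict-Fin-finite {n = zero} P? = 0 ,
  mkInverseₛ (λ ()) (λ ()) (λ { {() , _} }) (λ { {()} }) (λ ()) (λ { (() , _) })
Restrict-Fin-finite {n = suc n} {P} P? with P? zero | Restrict-Fin-finite (P? ∘ suc)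
... | yes p₀ | m , I = suc m , mkInverseₛ
  (λ { (zero , _) → zero ; (suc i , pᵢ) → suc (to (i , pᵢ)) })
  (λ { zero → zero , p₀ ; (suc k) → Product.map suc id (from k) })
  (λ { {zero , _} {zero , _} _ → refl
     ; {suc _ , _} {suc _ , _} i≡j → cong suc (to-cong (Fin.suc-injective i≡j)) })
  (λ { refl → refl })
  (λ { zero → refl ; (suc k) → cong suc (strictlyInverseˡ k) })
  (λ { (zero , _) → refl ; (suc i , pᵢ) → cong suc (strictlyInverseʳ (i , pᵢ)) })
  where open Inverse I
... | no ¬p₀ | m , I = m , mkInverseₛ
  (λ { (zero , p₀) → ⊥-elim (¬p₀ p₀) ; (suc i , pᵢ) → to (i , pᵢ) })
  (λ k → Product.map suc id (from k))
  (λ { {zero , p₀} _ → ⊥-elim (¬p₀ p₀)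
     ; {suc _ , _} {zero , p₀} _ → ⊥-elim (¬p₀ p₀)
     ; {suc _ , _} {suc _ , _} i≡j → to-cong (Fin.suc-injective i≡j) })
  (λ { refl → refl })
  strictlyInverseˡ
  (λ { (zero , p₀) → ⊥-elim (¬p₀ p₀)
     ; (suc i , pᵢ) → cong suc (strictlyInverseʳ (i , pᵢ)) })
  where open Inverse I

-- The predicate is carried to `Fin n` along `from` and counted there; `P-resp` bridges `x` and
-- `from (to x)`.
Restrict-finite : {S : Setoid a ℓ} {P : Pred (Setoid.Carrier S) p} →
  HasCardinality S n → (∀ {x y} → Setoid._≈_ S x y → P x → P y) → Decidable P →
  ∃ (HasCardinality (Restrict S P))
Restrict-finite {S = S} {P} I P-resp P? =
  Product.map₂ (Compose.inverse (Restrict⁺ (λ { refl q → q }) I P⇔P∘from∘to))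
    (Restrict-Fin-finite (P? ∘ from))
  where
  open Inverse I

  P⇔P∘from∘to : ∀ x → P x ⇔ P (from (to x))
  P⇔P∘from∘to x = mk⇔ (P-resp (Setoid.sym S (strictlyInverseʳ x)))
                      (P-resp (strictlyInverseʳ x))

funToFin-cong : ∀ {m n} {f g : Fin m → Fin n} → (∀ i → f i ≡ g i) →
  Fin.funToFin f ≡ Fin.funToFin g
funToFin-cong {zero}  f≗g = refl
funToFin-cong {suc m} f≗g = cong₂ Fin.combine (f≗g zero) (funToFin-cong (f≗g ∘ suc))

-- A function is encoded as an `m`-digit numeral in base `n`. Since functions are compared
-- pointwise, `funToFin-cong` takes the place of function extensionality.
→-finite : {A : Set a} {B : Set b} {m n : ℕ} → A ↔ Fin m → B ↔ Fin n →
  HasCardinality (A →-setoid B) (n ℕ.^ m)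
→-finite {m = m} {n} I J = mkInverseₛ
  (λ f → Fin.funToFin (J.to ∘ f ∘ I.from))
  (λ k → J.from ∘ Fin.finToFun k ∘ I.to)
  (λ f≗g → funToFin-cong (λ i → cong J.to (f≗g (I.from i))))
  (λ { refl x → refl })
  (λ k → ≡.trans
    (funToFin-cong λ i → ≡.trans (J.strictlyInverseˡ _)
                                 (cong (Fin.finToFun k) (I.strictlyInverseˡ i)))
    (Fin.funToFin-finToFin {m} {n} k))
  (λ f x → ≡.trans
    (cong J.from (Fin.finToFun-funToFin (J.to ∘ f ∘ I.from) (I.to x)))
    (≡.trans (J.strictlyInverseʳ _) (cong f (I.strictlyInverseʳ x))))
  where
  module I = Inverse I
  module J = Inverse J

-- Balanced assignments

Sign↔Fin2 : Sign ↔ Fin 2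
Sign↔Fin2 = mk↔ₛ′ (λ { Sign.+ → zero ; Sign.- → suc zero })
  (λ { zero → Sign.+ ; (suc zero) → Sign.- })
  (λ { zero → refl ; (suc zero) → refl }) (λ { Sign.+ → refl ; Sign.- → refl })

Crease↔Fin : Crease r c ↔ Fin (r ℕ.* suc c ℕ.+ c ℕ.* suc r)
Crease↔Fin = ↔-trans
  (mk↔ₛ′ (λ { (horizontal i j) → inj₁ (i , j) ; (zigzag j i) → inj₂ (j , i) })
         (λ { (inj₁ (i , j)) → horizontal i j ; (inj₂ (j , i)) → zigzag j i })
         (λ { (inj₁ _) → refl ; (inj₂ _) → refl })
         (λ { (horizontal _ _) → refl ; (zigzag _ _) → refl }))
  (↔-sym (↔-trans Fin.+↔⊎ (Fin.*↔× ⊎-↔ Fin.*↔×)))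

twist : (Fin c → Sign) → MVAssignment r c → MVAssignment r c
twist ε μ (horizontal i j) = μ (horizontal i j)
twist ε μ (zigzag j i)     = ε j Sign.* μ (zigzag j i)

*-involutive : ∀ s t → s Sign.* (s Sign.* t) ≡ t
*-involutive s t =
  ≡.trans (≡.sym (Sign.*-assoc s s t)) (cong (Sign._* t) (Sign.s*s≡+ s))

-- Signs square to 1, so `twist ε` is its own inverse.
twist-inverse : (Fin c → Sign) →
  Inverse (Crease r c →-setoid Sign) (Crease r c →-setoid Sign)
twist-inverse {c} {r} ε =
  mkInverseₛ (twist ε) (twist ε) twist-cong twist-cong twist² twist²
  where
  twist-cong : {μ ν : MVAssignment r c} → (∀ x → μ x ≡ ν x) →
    ∀ x → twist ε μ x ≡ twist ε ν x
  twist-cong μ≗ν (horizontal i j) = μ≗ν (horizontal i j)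
  twist-cong μ≗ν (zigzag j i)     = cong (ε j Sign.*_) (μ≗ν (zigzag j i))

  twist² : (μ : MVAssignment r c) → ∀ x → twist ε (twist ε μ) x ≡ μ x
  twist² μ (horizontal i j) = refl
  twist² μ (zigzag j i)     = *-involutive (ε j) (μ (zigzag j i))

-- East stands in the heel's place whichever way the foot points; the two orientations then differ
-- only in the sign on the zig-zag labels.
BalancedAt : MVAssignment r c → Sign → Vertex r c → Set
BalancedAt μ σ v = ToeSum (μ (creaseAt v east)) (σ Sign.* μ (creaseAt v north))
                          (μ (creaseAt v west)) (σ Sign.* μ (creaseAt v south))

-- Line `i` lies at height `suc (toℕ i)`, whence the shift. The sign is that of the vertex's
-- displacement with the factor `ε j` removed.
Balanced : MVAssignment r c → Set
Balanced μ = ∀ v → BalancedAt μ (alternating (suc (toℕ (proj₁ v)))) v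

toeSum? : ∀ h s m t → Dec (ToeSum h s m t)
toeSum? h s m t = value h ℤ.≟ value s ℤ.+ value m ℤ.+ value t

balancedAt? : ∀ (μ : MVAssignment r c) σ v → Dec (BalancedAt μ σ v)
balancedAt? μ σ v = toeSum? (μ (creaseAt v east)) (σ Sign.* μ (creaseAt v north))
                            (μ (creaseAt v west)) (σ Sign.* μ (creaseAt v south))

balanced? : Decidable (Balanced {r} {c})
balanced? μ = map′ uncurry curry
  (Fin.all? λ i → Fin.all? λ j → balancedAt? μ (alternating (suc (toℕ i))) (i , j))

ToeSum-resp : ∀ {h h′ s s′ m m′ t t′} → h ≡ h′ → s ≡ s′ → m ≡ m′ → t ≡ t′ →
  ToeSum h s m t → ToeSum h′ s′ m′ t′
ToeSum-resp refl refl refl refl h = h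

Balanced-resp : {μ ν : MVAssignment r c} → (∀ x → μ x ≡ ν x) → Balanced μ → Balanced ν
Balanced-resp μ≗ν balanced v@(i , _) = ToeSum-resp
  (at east) (cong (σ Sign.*_) (at north)) (at west) (cong (σ Sign.*_) (at south))
  (balanced v)
  where
  σ = alternating (suc (toℕ i))
  at = λ p → μ≗ν (creaseAt v p)

-- This supplies the common count: it is chosen from `r` and `c` alone, before any pattern is given.
Balanced-finite : ∀ r c →
  ∃ (HasCardinality (Restrict (Crease r c →-setoid Sign) Balanced))
Balanced-finite r c =
  Restrict-finite (→-finite Crease↔Fin Sign↔Fin2) Balanced-resp balanced?

-- Both zig-zag creases at a vertex belong to the same zig-zag `j`, so the factor `ε j` can be moved
-- from the vertex sign onto their labels.
BalancedAt-twist : ∀ (ε : Fin c → Sign) (μ : MVAssignment r c) σ v →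
  BalancedAt μ (ε (proj₂ v) Sign.* σ) v ⇔ BalancedAt (twist ε μ) σ v
BalancedAt-twist ε μ σ v@(i , j) = mk⇔
  (ToeSum-resp refl (εσ≡σε _) refl (εσ≡σε _))
  (ToeSum-resp refl (≡.sym (εσ≡σε _)) refl (≡.sym (εσ≡σε _)))
  where
  εσ≡σε : ∀ s → ε j Sign.* σ Sign.* s ≡ σ Sign.* (ε j Sign.* s)
  εσ≡σε s = ≡.trans (cong (Sign._* s) (Sign.*-comm (ε j) σ)) (Sign.*-assoc σ (ε j) s)

-- Flat folding at a vertex as a balance equation

heel : Sign → Port
heel Sign.+ = east
heel Sign.- = west

FoldsFlatFrom : MVAssignment r c → Vertex r c → Port → Set
FoldsFlatFrom μ v h = FoldsFlat (μ (creaseAt v h)) (μ (creaseAt v (next h)))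
  (μ (creaseAt v (next (next h)))) (μ (creaseAt v (next (next (next h)))))

-- For an east heel the toe sum is already the balance equation. For a west heel it reads W = S + E
-- + N, which is solved for E; `exchange` checks this over all sixteen sign choices.
foldsFlat⇔balancedAt : (μ : MVAssignment r c) (v : Vertex r c) → ∀ σ →
  FoldsFlatFrom μ v (heel σ) ⇔ BalancedAt μ σ v
foldsFlat⇔balancedAt μ v Sign.+ = foldsFlat⇔toeSum _ _ _ _
foldsFlat⇔balancedAt μ v Sign.- = exchange ⇔-∘ foldsFlat⇔toeSum _ _ _ _
  where
  E = μ (creaseAt v east)
  N = μ (creaseAt v north)
  W = μ (creaseAt v west)
  S = μ (creaseAt v south)

  exchange : ToeSum W S E N ⇔ ToeSum E (opposite N) W (opposite S)
  exchange = uncurry mk⇔ (both E N W S)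
    where
    both : ∀ e n w s → (ToeSum w s e n → ToeSum e (opposite n) w (opposite s))
                     × (ToeSum e (opposite n) w (opposite s) → ToeSum w s e n)
    both = from-yes (all-signs? λ e → all-signs? λ n → all-signs? λ w →
      all-signs? λ s →
        (toeSum? w s e n →-dec toeSum? e (opposite n) w (opposite s)) ×-dec
        (toeSum? e (opposite n) w (opposite s) →-dec toeSum? w s e n))

-- The crease east of vertex `j` ends at a later zig-zag or at the right edge. This treats both
-- cases at once, and `∷-inject₁` does the same to the west.
snoc-suc : {A : Set a} (P : Pred A p) {f : Fin n → A} {x : A} (j : Fin n) →
  (∀ k → j Fin.< k → P (f k)) → P x → P (snoc f x (suc j))
snoc-suc {n = suc zero}    P zero    Pf Px = Px
snoc-suc {n = suc (suc n)} P zero    Pf Px = Pf (suc zero) (ℕ.s≤s ℕ.z≤n)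
snoc-suc {n = suc n}       P (suc j) Pf Px =
  snoc-suc P j (λ k j<k → Pf (suc k) (ℕ.s≤s j<k)) Px

∷-inject₁ : {A : Set a} (P : Pred A p) {f : Fin n → A} {x : A} (j : Fin n) →
  (∀ k → k Fin.< j → P (f k)) → P x → P ((x Vector.∷ f) (inject₁ j))
∷-inject₁ P zero    Pf Px = Px
∷-inject₁ P (suc j) Pf Px = Pf (inject₁ j) (Fin.≤̄⇒inject₁< ℕ.≤-refl)

-- Positions of the creases around a vertex

module _ (F : OrderedField a ℓ₁ ℓ₂) where
  open OrderedField F hiding (refl; sym; trans; setoid; zero)
  open RingProperties ring using (-‿distribˡ-*; -‿distribʳ-*)
  open AbelianGroupProperties +-abelianGroup using (⁻¹-anti-homo‿-; ⁻¹-involutive)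
  open IsStrictTotalOrder isStrictTotalOrder using (<-respˡ-≈; <-respʳ-≈; asym)
    renaming (trans to <-trans)

  private module ≈ = Setoid (OrderedField.setoid F)

  -- Stating either sign as a positivity lets `*-pos` yield the whole rule of signs for products.
  HasSign : Sign → Carrier → Set ℓ₂
  HasSign s x = 0# < signed F s x

  HasSign-resp : ∀ s {x y} → x ≈ y → HasSign s x → HasSign s y
  HasSign-resp Sign.+ x≈y = <-respʳ-≈ x≈y
  HasSign-resp Sign.- x≈y = <-respʳ-≈ (-‿cong x≈y)

  signed-* : ∀ s t x y → signed F s x * signed F t y ≈ signed F (s Sign.* t) (x * y)
  signed-* Sign.+ Sign.+ x y = ≈.refl
  signed-* Sign.+ Sign.- x y = ≈.sym (-‿distribʳ-* x y)
  signed-* Sign.- Sign.+ x y = ≈.sym (-‿distribˡ-* x y)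
  signed-* Sign.- Sign.- x y = begin
    - x * - y     ≈⟨ -‿distribˡ-* x (- y) ⟨
    - (x * - y)   ≈⟨ -‿cong (-‿distribʳ-* x y) ⟨
    - - (x * y)   ≈⟨ ⁻¹-involutive (x * y) ⟩
    x * y         ∎
    where open ≈-Reasoning (OrderedField.setoid F)

  HasSign-* : ∀ s t {x y} → HasSign s x → HasSign t y → HasSign (s Sign.* t) (x * y)
  HasSign-* s t {x} {y} x-sign y-sign =
    <-respʳ-≈ (signed-* s t x y) (*-pos x-sign y-sign)

  x<y⇒0<y-x : ∀ {x y} → x < y → 0# < y - x
  x<y⇒0<y-x {x} {y} x<y =
    <-respˡ-≈ (-‿inverseˡ x) (<-respʳ-≈ (+-comm (- x) y) (+-monoʳ-< (- x) x<y))

  x<y⇒x-y-negative : ∀ {x y} → x < y → HasSign Sign.- (x - y)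
  x<y⇒x-y-negative {x} {y} x<y =
    <-respʳ-≈ (≈.sym (⁻¹-anti-homo‿- x y)) (x<y⇒0<y-x x<y)

  0<x⇒-x<0 : ∀ {x} → 0# < x → - x < 0#
  0<x⇒-x<0 {x} 0<x =
    <-respˡ-≈ (+-identityʳ (- x)) (<-respʳ-≈ (-‿inverseˡ x) (+-monoʳ-< (- x) 0<x))

  HasSign-negative : ∀ {x} → HasSign Sign.- x → x < 0#
  HasSign-negative {x} 0<-x = <-respˡ-≈ (⁻¹-involutive x) (0<x⇒-x<0 0<-x)

  -- The two points lie on opposite sides of the axis `x`, so -δ < δ settles the order.
  HasSign-signed-difference : ∀ s {x δ} → 0# < δ →
    HasSign s ((x + signed F s δ) - (x + signed F (opposite s) δ))
  HasSign-signed-difference Sign.+ {x} 0<δ =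
    x<y⇒0<y-x (+-monoʳ-< x (<-trans (0<x⇒-x<0 0<δ) 0<δ))
  HasSign-signed-difference Sign.- {x} 0<δ =
    x<y⇒x-y-negative (+-monoʳ-< x (<-trans (0<x⇒-x<0 0<δ) 0<δ))

  -- Every sector at a vertex is bordered by a horizontal crease. Its dot product therefore reduces
  -- to a product of horizontal components, and heights drop out.
  HasSign-dot : ∀ s t {d e : Point F} → HasSign s (proj₁ d) → proj₂ d ≈ 0# →
    HasSign t (proj₁ e) → HasSign (s Sign.* t) (dot F d e)
  HasSign-dot s t {d₁ , d₂} {e₁ , e₂} d-sign d₂≈0 e-sign =
    HasSign-resp (s Sign.* t) (≈.sym dot≈d₁*e₁) (HasSign-* s t d-sign e-sign)
    where
    open ≈-Reasoning (OrderedField.setoid F)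

    dot≈d₁*e₁ : d₁ * e₁ + d₂ * e₂ ≈ d₁ * e₁
    dot≈d₁*e₁ = begin
      d₁ * e₁ + d₂ * e₂   ≈⟨ +-congˡ (*-congʳ d₂≈0) ⟩
      d₁ * e₁ + 0# * e₂   ≈⟨ +-congˡ (zeroˡ e₂) ⟩
      d₁ * e₁ + 0#        ≈⟨ +-identityʳ _ ⟩
      d₁ * e₁             ∎

  dot-comm : ∀ d e → dot F d e ≈ dot F e d
  dot-comm (d₁ , d₂) (e₁ , e₂) = +-cong (*-comm d₁ e₁) (*-comm d₂ e₂)

  -- The bird's feet of a fixed pattern

  module _ (P : ModifiedMiuraOri F r c) where
    open ModifiedMiuraOri P hiding (IsStandard; locallyValidAssignments)

    tilt : Vertex r c → Sign
    tilt (i , j) = ε j Sign.* alternating (suc (toℕ i))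

    -- The expected sign of a direction's horizontal component. Both zig-zag creases lean back
    -- across the axis, hence `opposite σ` for north and south.
    side : Sign → Port → Sign
    side σ east  = Sign.+
    side σ north = opposite σ
    side σ west  = Sign.-
    side σ south = opposite σ

    height≤ : (i : Fin r) → suc (toℕ i) ℕ.≤ suc r
    height≤ i = ℕ.s≤s (ℕ.<⇒≤ (Fin.toℕ<n i))

    HasSign-neighbour : ∀ i i′ (j : Fin c) → alternating i ≡ opposite (alternating i′) →
      HasSign (opposite (ε j Sign.* alternating i′)) (abscissa i j - abscissa i′ j)
    -- After the rewrite both abscissas depend on the same two signs, and each of the four cases
    -- computes to a displacement and its opposite.
    HasSign-neighbour i i′ j alt
      rewrite alt with ε j | alternating i′
    ... | Sign.+ | Sign.+ = HasSign-signed-difference Sign.- 0<δ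
    ... | Sign.+ | Sign.- = HasSign-signed-difference Sign.+ 0<δ
    ... | Sign.- | Sign.+ = HasSign-signed-difference Sign.+ 0<δ
    ... | Sign.- | Sign.- = HasSign-signed-difference Sign.- 0<δ

    HasSign-direction : ∀ v p → HasSign (side (tilt v) p) (proj₁ (direction v p))
    HasSign-direction (i , j) east = snoc-suc
      (λ q → HasSign Sign.+ (proj₁ q - abscissa (suc (toℕ i)) j)) j
      (λ k j<k → x<y⇒0<y-x (disjoint (height≤ i) j<k))
      (x<y⇒0<y-x (zigzag<right j (height≤ i)))
    HasSign-direction (i , j) north =
      HasSign-neighbour (suc (suc (toℕ i))) (suc (toℕ i)) j refl
    HasSign-direction (i , j) west = ∷-inject₁
      (λ q → HasSign Sign.- (proj₁ q - abscissa (suc (toℕ i)) j)) j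
      (λ k k<j → x<y⇒x-y-negative (disjoint (height≤ i) k<j))
      (x<y⇒x-y-negative (left<zigzag j (height≤ i)))
    -- Northward the alternation holds by definition; southward it is read backwards, which takes a
    -- double `opposite`.
    HasSign-direction (i , j) south = HasSign-neighbour (toℕ (inject₁ i)) (suc (toℕ i)) j
      (≡.trans (cong alternating (Fin.toℕ-inject₁ i))
               (≡.sym (Sign.opposite-involutive (alternating (toℕ i)))))

    east-horizontal : ∀ v → proj₂ (direction v east) ≈ 0#
    east-horizontal (i , j) = snoc-suc
      (λ q → proj₂ q - fromℕ F (suc (toℕ i)) ≈ 0#) j
      (λ _ _ → -‿inverseʳ _) (-‿inverseʳ _)

    west-horizontal : ∀ v → proj₂ (direction v west) ≈ 0#
    west-horizontal (i , j) = ∷-inject₁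
      (λ q → proj₂ q - fromℕ F (suc (toℕ i)) ≈ 0#) j
      (λ _ _ → -‿inverseʳ _) (-‿inverseʳ _)

    HasSign-dot-east : ∀ v q {s} → side (tilt v) q ≡ s →
      HasSign s (dot F (direction v east) (direction v q))
    HasSign-dot-east v q refl = HasSign-dot Sign.+ (side (tilt v) q)
      (HasSign-direction v east) (east-horizontal v) (HasSign-direction v q)

    HasSign-dot-west : ∀ v q {s} → side (tilt v) q ≡ s →
      HasSign (opposite s) (dot F (direction v west) (direction v q))
    HasSign-dot-west v q refl = HasSign-dot Sign.- (side (tilt v) q)
      (HasSign-direction v west) (west-horizontal v) (HasSign-direction v q)

    Obtuse-sym : ∀ v p q → Obtuse v p q → Obtuse v q p
    Obtuse-sym v p q = <-respˡ-≈ (dot-comm (direction v p) (direction v q))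

    east-obtuse : ∀ v q → side (tilt v) q ≡ Sign.- → Obtuse v east q
    east-obtuse v q eq = HasSign-negative (HasSign-dot-east v q eq)

    west-obtuse : ∀ v q → side (tilt v) q ≡ Sign.+ → Obtuse v west q
    west-obtuse v q eq = HasSign-negative (HasSign-dot-west v q eq)

    east-acute : ∀ v q → side (tilt v) q ≡ Sign.+ → ¬ Obtuse v east q
    east-acute v q eq = asym (HasSign-dot-east v q eq)

    west-acute : ∀ v q → side (tilt v) q ≡ Sign.- → ¬ Obtuse v west q
    west-acute v q eq = asym (HasSign-dot-west v q eq)

    -- The sign is a variable tied to `tilt v` by an equation so that it can be matched on.
    isHeel-heel : ∀ v {σ} → tilt v ≡ σ → IsHeel v (heel σ)
    isHeel-heel v {Sign.+} eq =
      east-obtuse v north (cong opposite eq) , east-obtuse v south (cong opposite eq)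
    isHeel-heel v {Sign.-} eq =
      west-obtuse v south (cong opposite eq) , west-obtuse v north (cong opposite eq)

    -- The two sectors at the crease opposite the heel are acute, and each port other than `heel σ`
    -- borders at least one of them.
    isHeel-unique : ∀ v {σ} h → tilt v ≡ σ → IsHeel v h → h ≡ heel σ
    isHeel-unique v {Sign.+} east  eq _        = refl
    isHeel-unique v {Sign.+} north eq (nw , _) =
      ⊥-elim (west-acute v north (cong opposite eq) (Obtuse-sym v north west nw))
    isHeel-unique v {Sign.+} west  eq (ws , _) =
      ⊥-elim (west-acute v south (cong opposite eq) ws)
    isHeel-unique v {Sign.+} south eq (_ , sw) =
      ⊥-elim (west-acute v south (cong opposite eq) (Obtuse-sym v south west sw))
    isHeel-unique v {Sign.-} east  eq (en , _) =
      ⊥-elim (east-acute v north (cong opposite eq) en)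
    isHeel-unique v {Sign.-} north eq (_ , ne) =
      ⊥-elim (east-acute v north (cong opposite eq) (Obtuse-sym v north east ne))
    isHeel-unique v {Sign.-} west  eq _        = refl
    isHeel-unique v {Sign.-} south eq (se , _) =
      ⊥-elim (east-acute v south (cong opposite eq) (Obtuse-sym v south east se))

    -- Existence and uniqueness of the heel collapse the existential in `LocallyValidAt` to the
    -- single port `heel (tilt v)`.
    locallyValidAt⇔balancedAt : ∀ μ v → LocallyValidAt μ v ⇔ BalancedAt μ (tilt v) v
    locallyValidAt⇔balancedAt μ v = foldsFlat⇔balancedAt μ v (tilt v) ⇔-∘ mk⇔
      (λ (h , isHeel , flat) → subst (FoldsFlatFrom μ v) (isHeel-unique v h refl isHeel) flat)
      (λ flat → heel (tilt v) , isHeel-heel v refl , flat)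

    -- Here the pattern leaves the equations: `tilt v` is `ε j` times the row sign, and the twist
    -- absorbs `ε j`.
    locallyValid⇔balanced : ∀ μ → LocallyValid μ ⇔ Balanced (twist ε μ)
    locallyValid⇔balanced μ = mk⇔ (λ valid v → to (valid-at v) (valid v))
                                  (λ balanced v → from (valid-at v) (balanced v))
      where
      open Equivalence

      valid-at : ∀ v → LocallyValidAt μ v ⇔
        BalancedAt (twist ε μ) (alternating (suc (toℕ (proj₁ v)))) v
      valid-at v =
        BalancedAt-twist ε μ _ v ⇔-∘ locallyValidAt⇔balancedAt μ v

    locallyValid↔balanced : Inverse (locallyValidAssignments P)
      (Restrict (Crease r c →-setoid Sign) Balanced)
    locallyValid↔balanced =
      Restrict⁺ Balanced-resp (twist-inverse ε) locallyValid⇔balanced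

theorem6 : {a ℓ₁ ℓ₂ : Level} (F : OrderedField a ℓ₁ ℓ₂) (m-1 n-1 : ℕ)
    (P Q : ModifiedMiuraOri F m-1 n-1) → IsStandard Q →
    ∃[ N ] (HasCardinality (locallyValidAssignments P) N
    × HasCardinality (locallyValidAssignments Q) N)
theorem6 F m-1 n-1 P Q _ = Product.map₂ (λ I → count I P , count I Q)
  (Balanced-finite m-1 n-1)
  where
  -- One enumeration of the balanced assignments is pulled back to any pattern `R`, in particular to
  -- `P` and to `Q`.
  count : ∀ {N} →
    HasCardinality (Restrict (Crease m-1 n-1 →-setoid Sign) Balanced) N →
    ∀ R → HasCardinality (locallyValidAssignments R) N
  count I R = Compose.inverse (locallyValid↔balanced F R) I
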